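{- Let $q=3^k$ with $k$ a positive even integer, and let $\mu_{q+1}=\{x\in\mathbb{F}_{q^2} : x^{q+1}=1\}$. Then the function $$g(x)=\frac{ -x^7+x^6+x}{x^6+x-1}$$ permutes $\mu_{q+1}$.
   Context: $\mathbb{F}_{q^2}$ is the finite field with $q^2$ elements and $\mu_{q+1}$ is the group of $(q+1)$-th roots of unity in it. A rational function "permutes" a set $S$ if it induces a well-defined bijection of $S$ onto itself. -}

module Defs where

open import Algebra.Apartness.Bundles using (HeytingField; HeytingCommutativeRing)
open import Algebra.Bundles using (CommutativeRing)
open import Data.Fin.Base using (Fin)
open import Data.Nat.Base using (ℕ)
open import Data.Product.Base using (∃; _,_; proj₁)
open import Function.Base using (_on_)
open import Function.Bundles using (Inverse)
open import Function.Structures using (IsBijection)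
open import Level using (Level; _⊔_)
open import Relation.Binary.PropositionalEquality.Properties as ≡ using ()
open import Relation.Unary using (Pred)

-- A Heyting field with finitely many elements is a field in the usual sense:
-- its equality is decidable, so by tightness x # y is equivalent to
-- ¬ (x ≈ y), and every x with ¬ (x ≈ 0#) is invertible.
module FieldDefs {c ℓ₁ ℓ₂ : Level} (F : HeytingField c ℓ₁ ℓ₂) where

  open HeytingField F public
  open HeytingCommutativeRing heytingCommutativeRing public
    using (commutativeRing)
  open CommutativeRing commutativeRing using (semiring)
  open import Algebra.Properties.Semiring.Exp semiring public using (_^_)

  HasCardinality : ℕ → Set (c ⊔ ℓ₁)
  HasCardinality n = Inverse setoid (≡.setoid (Fin n))

  μ : ℕ → Pred Carrier ℓ₁
  μ n x = x ^ n ≈ 1#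

  -- The library supplies an inverse of y - 0#, which is y up to _≈_.
  quotient : (x y : Carrier) → y # 0# → Carrier
  quotient x y y#0 = x * proj₁ (#⇒invertible y#0)

  -- For a fraction num / den in lowest terms, being defined at x means
  -- that den x is nonzero.
  record Permutes {s} (num den : Carrier → Carrier) (S : Pred Carrier s)
                  : Set (c ⊔ ℓ₁ ⊔ ℓ₂ ⊔ s) where
    field
      den#0  : ∀ x → S x → den x # 0#
      closed : ∀ x (x∈S : S x) → S (quotient (num x) (den x) (den#0 x x∈S))

    restriction : ∃ S → ∃ S
    restriction (x , x∈S) =
      quotient (num x) (den x) (den#0 x x∈S) , closed x x∈S

    field
      isBijection : IsBijection (_≈_ on proj₁) (_≈_ on proj₁) restriction

{-# OPTIONS --safe #-}
module Submission where

-- Write x̄ = x^q, which is 1 / x on μ_{q+1}, and g = num / den.  On μ_{q+1} one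
-- has num x = x⁷ den x̄, so g preserves μ_{q+1}; den does not vanish there
-- because it is coprime to its reciprocal polynomial.  By finiteness only
-- injectivity remains.  In characteristic 3, with s = x + y and p = x y,
--
--   num x den y - num y den x = - (x - y) (A² + B²),   B = (x - y) C,
--
-- for symmetric polynomials A and C in s and p that are self-reciprocal, so
-- that Ā p³ = A and B̄ p³ = - B on μ_{q+1}.  If A² + B² = 0 with B ≠ 0, then
-- A / B is a square root of -1 which conjugation negates; but for even k these
-- square roots lie in 𝔽_q.  Hence A = B = 0, and if x ≠ y also C = 0, which
-- forces x² = -1 or y² = -1, again impossible on μ_{q+1} for even k.

open import Defs
open import Algebra.Apartness.Bundles using (HeytingField)
import Data.Nat.Base as ℕ
open import Data.Nat.Base using (ℕ)
open import Data.Nat.Divisibility using (_∣_; divides)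

open import Algebra.Bundles using (CommutativeRing; RawRing)
open import Algebra.Solver.Ring.AlmostCommutativeRing
  using (fromCommutativeRing; _-Raw-AlmostCommutative⟶_)
open import Data.Empty using (⊥)
open import Data.Fin.Base using (Fin; punchOut)
open import Data.Fin.Patterns using (0F; 1F; 2F)
open import Data.Fin.Permutation using (Permutation; permutation)
import Data.Fin.Properties as Fin
open import Data.Fin.Properties using (any?; injective⇒≤; punchOut-injective)
open import Data.Maybe.Base using (Maybe; just; nothing)
import Data.Nat.Properties as ℕ
open import Data.Product.Base using (∃; _×_; _,_; proj₁; proj₂)
open import Data.Sum.Base using (_⊎_; inj₁; inj₂; [_,_]′)
open import Data.Unit.Base using (tt)
open import Data.Vec.Base using ([]; _∷_; map)
open import Data.Vec.Properties using (lookup-map)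
open import Data.Vec.Relation.Binary.Pointwise.Inductive as Pointwise using (Pointwise; []; _∷_)
open import Function.Base using (_on_; _∘_)
open import Function.Bundles using (Inverse; Injection)
open import Function.Definitions using (Injective; StrictlySurjective)
open import Function.Properties.Inverse using (Inverse⇒Injection)
open import Level using (0ℓ)
open import Relation.Binary.Bundles using (Setoid)
import Relation.Binary.Construct.On as On
open import Relation.Binary.Definitions using (Decidable; _Respects_)
open import Relation.Binary.PropositionalEquality as ≡ using (_≡_; _≢_)
open import Relation.Nullary using (¬_; yes; no; contradiction)
open import Relation.Nullary.Decidable using (Dec; decidable-stable; via-injection)
open import Relation.Unary as Unary using (Pred)

-- Injective self-maps of finite sets and finite setoids.

injective⇒strictlySurjective : ∀ {n} {f : Fin n → Fin n} →
                               Injective _≡_ _≡_ f → StrictlySurjective _≡_ f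
injective⇒strictlySurjective {ℕ.suc n} {f} f-injective y with any? (λ x → f x Fin.≟ y)
... | yes hit  = hit
-- Punching the missed value `y` out of the codomain leaves an injection from `suc n` elements into
-- `n`.
... | no  miss = contradiction (injective⇒≤ punchOut∘f-injective) ℕ.1+n≰n
  where
  y≢f : ∀ x → y ≢ f x
  y≢f x y≡fx = miss (x , ≡.sym y≡fx)
  punchOut∘f-injective : Injective _≡_ _≡_ (λ x → punchOut (y≢f x))
  punchOut∘f-injective eq = f-injective (punchOut-injective (y≢f _) (y≢f _) eq)

module FiniteSetoid {c ℓ} (S : Setoid c ℓ) {n} (card : Inverse S (≡.setoid (Fin n))) where

  open Setoid S
  open Inverse card

  infix 4 _≟_

  _≟_ : Decidable _≈_
  _≟_ = via-injection (Inverse⇒Injection card) Fin._≟_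

  -- No count of `P` is made: extending `f` by the identity outside `P` gives an injection of the
  -- whole setoid, since values inside and outside `P` cannot agree. A preimage of an element of `P`
  -- under the extension must itself lie in `P`.
  injective⇒strictlySurjective-on :
    ∀ {p} {P : Pred Carrier p} → Unary.Decidable P → (f : ∃ P → ∃ P) →
    Injective (_≈_ on proj₁) (_≈_ on proj₁) f → P Respects _≈_ →
    StrictlySurjective (_≈_ on proj₁) f
  injective⇒strictlySurjective-on {P = P} P? f f-injective P-resp (y , y∈P) = surjective
    where
    -- The decision is an explicit argument so that the proofs below can split on it directly.
    extend : ∀ x → Dec (P x) → Carrier
    extend x (yes x∈P) = proj₁ (f (x , x∈P))
    extend x (no  _)   = x

    extend-injective : ∀ {x x′} (d : Dec (P x)) (d′ : Dec (P x′)) →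
                       extend x d ≈ extend x′ d′ → x ≈ x′
    extend-injective (yes _)   (yes _)   eq = f-injective eq
    extend-injective (yes x∈P) (no x′∉P) eq = contradiction (P-resp eq (proj₂ (f (_ , x∈P)))) x′∉P
    extend-injective (no x∉P) (yes x′∈P) eq = contradiction (P-resp (sym eq) (proj₂ (f (_ , x′∈P)))) x∉P
    extend-injective (no _)    (no _)    eq = eq

    to-injective : ∀ {x y} → to x ≡ to y → x ≈ y
    to-injective = Injection.injective (Inverse⇒Injection card)

    onFin : Fin n → Fin n
    onFin i = to (extend (from i) (P? (from i)))

    onFin-injective : Injective _≡_ _≡_ onFin
    onFin-injective {i} {j} eq = ≡.trans (≡.sym (strictlyInverseˡ i)) (≡.trans
      (to-cong (extend-injective (P? (from i)) (P? (from j)) (to-injective eq))) (strictlyInverseˡ j))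

    preimage : ∀ x (d : Dec (P x)) → extend x d ≈ y → ∃ λ x → proj₁ (f x) ≈ y
    preimage x (yes x∈P) eq = (x , x∈P) , eq
    preimage x (no x∉P)  eq = contradiction (P-resp (sym eq) y∈P) x∉P

    surjective : ∃ λ x → proj₁ (f x) ≈ y
    surjective with i , eq ← injective⇒strictlySurjective onFin-injective (to y) =
      preimage (from i) (P? (from i)) (to-injective eq)

-- The cardinality of a finite ring vanishes in it.

module FiniteRing {c ℓ} (R : CommutativeRing c ℓ)
  {n} (card : Inverse (CommutativeRing.setoid R) (≡.setoid (Fin n))) where

  open CommutativeRing R
  open Inverse card
  open import Algebra.Properties.Ring ring using (+-cancelˡ)
  open import Algebra.Properties.Semiring.Mult semiring using () renaming (_×_ to _·_)
  open import Algebra.Properties.CommutativeMonoid.Sum +-commutativeMonoid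
  open import Relation.Binary.Reasoning.Setoid setoid

  -- Adding 1 permutes the ring, so it does not change the sum of all elements.
  cardinality×1≈0 : n · 1# ≈ 0#
  cardinality×1≈0 = +-cancelˡ (sum from) (n · 1#) 0# (begin
    sum from + n · 1#                       ≈⟨ +-congˡ (sum-replicate n) ⟨
    sum from + sum {n} (λ _ → 1#)           ≈⟨ ∑-distrib-+ from (λ _ → 1#) ⟨
    sum (λ i → from i + 1#)                 ≈⟨ sum-cong-≋ (λ i → strictlyInverseʳ (from i + 1#)) ⟨
    sum (λ i → from (to (from i + 1#)))     ≈⟨ sum-permute from shift ⟨
    sum from                                ≈⟨ +-identityʳ (sum from) ⟨
    sum from + 0#                           ∎)
    where
    cancels : ∀ a b → a + b ≈ 0# → ∀ i → to (from (to (from i + a)) + b) ≡ i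
    cancels a b a+b≈0 i = ≡.trans (to-cong (begin
      from (to (from i + a)) + b   ≈⟨ +-congʳ (strictlyInverseʳ (from i + a)) ⟩
      from i + a + b               ≈⟨ +-assoc (from i) a b ⟩
      from i + (a + b)             ≈⟨ +-congˡ a+b≈0 ⟩
      from i + 0#                  ≈⟨ +-identityʳ (from i) ⟩
      from i                       ∎)) (strictlyInverseˡ i)
    shift : Permutation n n
    shift = permutation (λ i → to (from i + 1#)) (λ i → to (from i - 1#))
      (cancels (- 1#) 1# (-‿inverseˡ 1#)) (cancels 1# (- 1#) (-‿inverseʳ 1#))

-- Polynomial identities in characteristic 3.

-- This serves as the coefficient ring of the solver: its operations compute, so identities that
-- hold only modulo 3 are settled by normalisation.
data 𝔽₃ : Set where
  0₃ 1₃ -1₃ : 𝔽₃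

module F₃ where

  infix  8 -_
  infixl 7 _*_
  infixl 6 _+_

  -_ : 𝔽₃ → 𝔽₃
  - 0₃  = 0₃
  - 1₃  = -1₃
  - -1₃ = 1₃

  _+_ : 𝔽₃ → 𝔽₃ → 𝔽₃
  0₃  + b   = b
  a   + 0₃  = a
  1₃  + 1₃  = -1₃
  1₃  + -1₃ = 0₃
  -1₃ + 1₃  = 0₃
  -1₃ + -1₃ = 1₃

  _*_ : 𝔽₃ → 𝔽₃ → 𝔽₃
  0₃  * b = 0₃
  1₃  * b = b
  -1₃ * b = - b

  rawRing : RawRing 0ℓ 0ℓ
  rawRing = record
    { _≈_ = _≡_ ; _+_ = _+_ ; _*_ = _*_ ; -_ = -_ ; 0# = 0₃ ; 1# = 1₃ }

ThreeIsZero : ∀ {c ℓ} → CommutativeRing c ℓ → Set ℓ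
ThreeIsZero R = 1# + 1# + 1# ≈ 0#
  where open CommutativeRing R

module CharacteristicThree {c ℓ} (R : CommutativeRing c ℓ) (3≈0 : ThreeIsZero R) where

  open CommutativeRing R
  open import Algebra.Properties.Ring ring
    using (-0#≈0#; -‿+-comm; -‿involutive; -1*x≈-x; +-cancelʳ)
  open import Algebra.Properties.CommutativeSemiring.Exp commutativeSemiring public
  open import Relation.Binary.Reasoning.Setoid setoid

  1+1≈-1 : 1# + 1# ≈ - 1#
  1+1≈-1 = +-cancelʳ 1# (1# + 1#) (- 1#) (trans 3≈0 (sym (-‿inverseˡ 1#)))

  embed : 𝔽₃ → Carrier
  embed 0₃  = 0#
  embed 1₃  = 1#
  embed -1₃ = - 1#

  embed-neg : ∀ a → embed (F₃.- a) ≈ - embed a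
  embed-neg 0₃  = sym -0#≈0#
  embed-neg 1₃  = refl
  embed-neg -1₃ = sym (-‿involutive 1#)

  embed-+ : ∀ a b → embed (a F₃.+ b) ≈ embed a + embed b
  embed-+ 0₃  b   = sym (+-identityˡ _)
  embed-+ 1₃  0₃  = sym (+-identityʳ _)
  embed-+ 1₃  1₃  = sym 1+1≈-1
  embed-+ 1₃  -1₃ = sym (-‿inverseʳ 1#)
  embed-+ -1₃ 0₃  = sym (+-identityʳ _)
  embed-+ -1₃ 1₃  = sym (-‿inverseˡ 1#)
  embed-+ -1₃ -1₃ = begin
    1#              ≈⟨ -‿involutive 1# ⟨
    - - 1#          ≈⟨ -‿cong 1+1≈-1 ⟨
    - (1# + 1#)     ≈⟨ -‿+-comm 1# 1# ⟨
    - 1# + - 1#     ∎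

  embed-* : ∀ a b → embed (a F₃.* b) ≈ embed a * embed b
  embed-* 0₃  b = sym (zeroˡ _)
  embed-* 1₃  b = sym (*-identityˡ _)
  embed-* -1₃ b = trans (embed-neg b) (sym (-1*x≈-x _))

  -- The solver only has to recognise equal coefficients. Distinct ones are left undecided, since
  -- `embed` need not be injective in an arbitrary `R`.
  _embed≟_ : ∀ a b → Maybe (embed a ≈ embed b)
  0₃  embed≟ 0₃  = just refl
  1₃  embed≟ 1₃  = just refl
  -1₃ embed≟ -1₃ = just refl
  _   embed≟ _   = nothing

  homomorphism : F₃.rawRing -Raw-AlmostCommutative⟶ fromCommutativeRing R
  homomorphism = record
    { ⟦_⟧ = embed ; +-homo = embed-+ ; *-homo = embed-* ; -‿homo = embed-neg
    ; 0-homo = refl ; 1-homo = refl }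

  open import Algebra.Solver.Ring F₃.rawRing (fromCommutativeRing R) homomorphism _embed≟_ public
    using (Polynomial; op; [+]; [*]; con; var; _:^_; :-_; _:+_; _:*_; _:-_; ⟦_⟧; Env; solve; _:=_)

  -- In characteristic 3 one has `- x - x = x`, so no division by 2 is involved.
  x≈-x⇒x≈0 : ∀ {x} → x ≈ - x → x ≈ 0#
  x≈-x⇒x≈0 {x} x≈-x = begin
    x             ≈⟨ solve 1 (λ x → x := :- x :- x) refl x ⟩
    - x - x       ≈⟨ +-congʳ x≈-x ⟨
    x - x         ≈⟨ -‿inverseʳ x ⟩
    0#            ∎

  cube-+ : ∀ x y → (x + y) ^ 3 ≈ x ^ 3 + y ^ 3
  cube-+ = solve 2 (λ x y → (x :+ y) :^ 3 := x :^ 3 :+ y :^ 3) refl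

  cube-neg : ∀ x → (- x) ^ 3 ≈ - x ^ 3
  cube-neg = solve 1 (λ x → (:- x) :^ 3 := :- (x :^ 3)) refl

  cube-embed : ∀ a → embed a ^ 3 ≈ embed a
  cube-embed 0₃  = zeroˡ _
  cube-embed 1₃  = solve 0 (con 1₃ :^ 3 := con 1₃) refl
  cube-embed -1₃ = solve 0 (con -1₃ :^ 3 := con -1₃) refl

  -- The iterated Frobenius map and its action on polynomial values.

  frob : ℕ → Carrier → Carrier
  frob k x = x ^ (3 ℕ.^ k)

  -- Putting the cube innermost matches the unfolding `3 ^ suc k = 3 * 3 ^ k`, so the inductions
  -- below reduce to the case of a single cube.
  frob-suc : ∀ k x → frob k (x ^ 3) ≈ frob (ℕ.suc k) x
  frob-suc k x = ^-assocʳ x 3 (3 ℕ.^ k)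

  frob-cong : ∀ k {x y} → x ≈ y → frob k x ≈ frob k y
  frob-cong k = ^-congˡ (3 ℕ.^ k)

  frob-+ : ∀ k x y → frob k (x + y) ≈ frob k x + frob k y
  frob-+ ℕ.zero    x y = trans (*-identityʳ _) (sym (+-cong (*-identityʳ x) (*-identityʳ y)))
  frob-+ (ℕ.suc k) x y = begin
    frob (ℕ.suc k) (x + y)                  ≈⟨ frob-suc k (x + y) ⟨
    frob k ((x + y) ^ 3)                    ≈⟨ frob-cong k (cube-+ x y) ⟩
    frob k (x ^ 3 + y ^ 3)                  ≈⟨ frob-+ k (x ^ 3) (y ^ 3) ⟩
    frob k (x ^ 3) + frob k (y ^ 3)         ≈⟨ +-cong (frob-suc k x) (frob-suc k y) ⟩
    frob (ℕ.suc k) x + frob (ℕ.suc k) y     ∎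

  frob-neg : ∀ k x → frob k (- x) ≈ - frob k x
  frob-neg ℕ.zero    x = trans (*-identityʳ _) (sym (-‿cong (*-identityʳ x)))
  frob-neg (ℕ.suc k) x = begin
    frob (ℕ.suc k) (- x)    ≈⟨ frob-suc k (- x) ⟨
    frob k ((- x) ^ 3)      ≈⟨ frob-cong k (cube-neg x) ⟩
    frob k (- x ^ 3)        ≈⟨ frob-neg k (x ^ 3) ⟩
    - frob k (x ^ 3)        ≈⟨ -‿cong (frob-suc k x) ⟩
    - frob (ℕ.suc k) x      ∎

  frob-embed : ∀ k a → frob k (embed a) ≈ embed a
  frob-embed ℕ.zero    a = *-identityʳ _
  frob-embed (ℕ.suc k) a = begin
    frob (ℕ.suc k) (embed a)  ≈⟨ frob-suc k (embed a) ⟨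
    frob k (embed a ^ 3)      ≈⟨ frob-cong k (cube-embed a) ⟩
    frob k (embed a)          ≈⟨ frob-embed k a ⟩
    embed a                   ∎

  ^-comm-^ : ∀ x m n → (x ^ m) ^ n ≈ (x ^ n) ^ m
  ^-comm-^ x m n = begin
    (x ^ m) ^ n     ≈⟨ ^-assocʳ x m n ⟩
    x ^ (m ℕ.* n)   ≈⟨ ^-congʳ x (ℕ.*-comm m n) ⟩
    x ^ (n ℕ.* m)   ≈⟨ ^-assocʳ x n m ⟨
    (x ^ n) ^ m     ∎

  -- A ring endomorphism that fixes the constants commutes with every polynomial over 𝔽₃. Induction
  -- on the syntax treats `num`, `den`, `A` and `C` all at once.
  frob-⟦⟧ : ∀ k {n} (e : Polynomial n) (ρ : Env n) →
            frob k (⟦ e ⟧ ρ) ≈ ⟦ e ⟧ (map (frob k) ρ)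
  frob-⟦⟧ k (op [+] e f) ρ = trans (frob-+ k _ _) (+-cong (frob-⟦⟧ k e ρ) (frob-⟦⟧ k f ρ))
  frob-⟦⟧ k (op [*] e f) ρ =
    trans (^-distrib-* _ _ (3 ℕ.^ k)) (*-cong (frob-⟦⟧ k e ρ) (frob-⟦⟧ k f ρ))
  frob-⟦⟧ k (con a)      ρ = frob-embed k a
  frob-⟦⟧ k (var i)      ρ = reflexive (≡.sym (lookup-map i (frob k) ρ))
  frob-⟦⟧ k (e :^ m)     ρ = trans (^-comm-^ _ m (3 ℕ.^ k)) (^-congˡ m (frob-⟦⟧ k e ρ))
  frob-⟦⟧ k (:- e)       ρ = trans (frob-neg k _) (-‿cong (frob-⟦⟧ k e ρ))

  ⟦⟧-cong : ∀ {n} (e : Polynomial n) {ρ ρ′} → Pointwise _≈_ ρ ρ′ → ⟦ e ⟧ ρ ≈ ⟦ e ⟧ ρ′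
  ⟦⟧-cong (op [+] e f) ρ≈ρ′ = +-cong (⟦⟧-cong e ρ≈ρ′) (⟦⟧-cong f ρ≈ρ′)
  ⟦⟧-cong (op [*] e f) ρ≈ρ′ = *-cong (⟦⟧-cong e ρ≈ρ′) (⟦⟧-cong f ρ≈ρ′)
  ⟦⟧-cong (con a)      ρ≈ρ′ = refl
  ⟦⟧-cong (var i)      ρ≈ρ′ = Pointwise.lookup ρ≈ρ′ i
  ⟦⟧-cong (e :^ m)     ρ≈ρ′ = ^-congˡ m (⟦⟧-cong e ρ≈ρ′)
  ⟦⟧-cong (:- e)       ρ≈ρ′ = -‿cong (⟦⟧-cong e ρ≈ρ′)

  -- The polynomials behind `g` and the identities between them.

  :1 : ∀ {n} → Polynomial n
  :1 = con 1₃

  -- As operations on solver syntax, these can be used in `solve`, evaluated in the ring, and passed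
  -- to `frob-⟦⟧`.
  :num :den : ∀ {n} → Polynomial n → Polynomial n
  :num x = :- (x :^ 7) :+ x :^ 6 :+ x
  :den x = x :^ 6 :+ x :- :1

  :A :C : ∀ {n} → Polynomial n → Polynomial n → Polynomial n
  :A s p = :1 :+ s :^ 2 :- p :+ s :^ 3 :- p :* s :+ p :* s :^ 2 :- p :^ 2 :+ p :^ 3
  :C s p = :1 :- s :- s :^ 2 :+ p :- p :* s :+ p :^ 2

  num den : Carrier → Carrier
  num x = ⟦ :num (var 0F) ⟧ (x ∷ [])
  den x = ⟦ :den (var 0F) ⟧ (x ∷ [])

  A C : Carrier → Carrier → Carrier
  A s p = ⟦ :A (var 0F) (var 1F) ⟧ (s ∷ p ∷ [])
  C s p = ⟦ :C (var 0F) (var 1F) ⟧ (s ∷ p ∷ [])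

  -- Over 𝔽₉ the curve g(x) = g(y) splits off the diagonal into A ± i B = 0;
  -- A and B were found from this factorisation.
  num-den-factorisation : ∀ x y →
    let a = A (x + y) (x * y) ; b = (x - y) * C (x + y) (x * y) in
    num x * den y - num y * den x ≈ - ((x - y) * (a ^ 2 + b ^ 2))
  num-den-factorisation = solve 2 (λ x y →
    let a = :A (x :+ y) (x :* y) ; b = (x :- y) :* :C (x :+ y) (x :* y) in
    :num x :* :den y :- :num y :* :den x := :- ((x :- y) :* (a :^ 2 :+ b :^ 2))) refl

  den-cong : ∀ {x y} → x ≈ y → den x ≈ den y
  den-cong x≈y = ⟦⟧-cong (:den (var 0F)) (x≈y ∷ [])

  num-cong : ∀ {x y} → x ≈ y → num x ≈ num y
  num-cong x≈y = ⟦⟧-cong (:num (var 0F)) (x≈y ∷ [])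

  -- For x in μ the conjugate of x is an inverse x̄ of x, so the conjugates of
  -- s = x + y and p = x y are s p̄ and p̄.  Treating u = x x̄ (or u = p p̄) as an
  -- independent variable, to be set to 1, makes the facts about conjugates
  -- polynomial identities.
  num≈x⁷*den-x̄ : ∀ {x x̄} → x * x̄ ≈ 1# → num x ≈ x ^ 7 * den x̄
  num≈x⁷*den-x̄ {x} {x̄} xx̄≈1 = begin
    num x                           ≈⟨ specialise x ⟩
    ⟦ H ⟧ (x ∷ 1# ∷ [])             ≈⟨ ⟦⟧-cong H (refl ∷ xx̄≈1 ∷ []) ⟨
    ⟦ H ⟧ (x ∷ x * x̄ ∷ [])          ≈⟨ homogenise x x̄ ⟨
    x ^ 7 * den x̄                   ∎
    where
    h : ∀ {n} → Polynomial n → Polynomial n → Polynomial n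
    h x u = x :* u :^ 6 :+ x :^ 6 :* u :- x :^ 7
    H = h (var 0F) (var 1F)
    homogenise : ∀ x x̄ → x ^ 7 * den x̄ ≈ ⟦ H ⟧ (x ∷ x * x̄ ∷ [])
    homogenise = solve 2 (λ x x̄ → x :^ 7 :* :den x̄ := h x (x :* x̄)) refl
    specialise : ∀ x → num x ≈ ⟦ H ⟧ (x ∷ 1# ∷ [])
    specialise = solve 1 (λ x → :num x := h x :1) refl

  -- For `x`, `y` in μ this substitution is conjugation of `s` and `p`; `p ^ 3` clears the highest
  -- power of `p̄` that it produces.
  reciprocal-A : ∀ s {p p̄} → p * p̄ ≈ 1# → A (s * p̄) p̄ * p ^ 3 ≈ A s p
  reciprocal-A s {p} {p̄} pp̄≈1 = begin
    A (s * p̄) p̄ * p ^ 3             ≈⟨ homogenise s p p̄ ⟩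
    ⟦ H ⟧ (s ∷ p ∷ p * p̄ ∷ [])      ≈⟨ ⟦⟧-cong H (refl ∷ refl ∷ pp̄≈1 ∷ []) ⟩
    ⟦ H ⟧ (s ∷ p ∷ 1# ∷ [])         ≈⟨ specialise s p ⟩
    A s p                           ∎
    where
    h : ∀ {n} → Polynomial n → Polynomial n → Polynomial n → Polynomial n
    -- Every `p̄` has absorbed one factor of `p ^ 3` to form `u`.
    h s p u = p :^ 3 :+ (s :^ 2 :* p :- s :* p :- p) :* u :^ 2 :- p :^ 2 :* u
              :+ (s :^ 3 :+ s :^ 2 :+ :1) :* u :^ 3
    H = h (var 0F) (var 1F) (var 2F)
    homogenise : ∀ s p p̄ → A (s * p̄) p̄ * p ^ 3 ≈ ⟦ H ⟧ (s ∷ p ∷ p * p̄ ∷ [])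
    homogenise = solve 3 (λ s p p̄ → :A (s :* p̄) p̄ :* p :^ 3 := h s p (p :* p̄)) refl
    specialise : ∀ s p → ⟦ H ⟧ (s ∷ p ∷ 1# ∷ []) ≈ A s p
    specialise = solve 2 (λ s p → h s p :1 := :A s p) refl

  -- Only `p ^ 2` is spent here; the third factor `p` goes to `x - y` in `B`.
  reciprocal-C : ∀ s {p p̄} → p * p̄ ≈ 1# → C (s * p̄) p̄ * p ^ 2 ≈ C s p
  reciprocal-C s {p} {p̄} pp̄≈1 = begin
    C (s * p̄) p̄ * p ^ 2             ≈⟨ homogenise s p p̄ ⟩
    ⟦ H ⟧ (s ∷ p ∷ p * p̄ ∷ [])      ≈⟨ ⟦⟧-cong H (refl ∷ refl ∷ pp̄≈1 ∷ []) ⟩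
    ⟦ H ⟧ (s ∷ p ∷ 1# ∷ [])         ≈⟨ specialise s p ⟩
    C s p                           ∎
    where
    h : ∀ {n} → Polynomial n → Polynomial n → Polynomial n → Polynomial n
    h s p u = p :^ 2 :+ (p :- s :* p) :* u :+ (:1 :- s :- s :^ 2) :* u :^ 2
    H = h (var 0F) (var 1F) (var 2F)
    homogenise : ∀ s p p̄ → C (s * p̄) p̄ * p ^ 2 ≈ ⟦ H ⟧ (s ∷ p ∷ p * p̄ ∷ [])
    homogenise = solve 3 (λ s p p̄ → :C (s :* p̄) p̄ :* p :^ 2 := h s p (p :* p̄)) refl
    specialise : ∀ s p → ⟦ H ⟧ (s ∷ p ∷ 1# ∷ []) ≈ C s p
    specialise = solve 2 (λ s p → h s p :1 := :C s p) refl

  -- A Bézout identity over 𝔽₃, with cofactors as given by the extended Euclidean algorithm;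
  -- `x ^ 6 - x ^ 5 - 1#` is minus the reciprocal polynomial of `den`.
  den-coprime-reciprocal : ∀ x →
    (x ^ 2 + x - x ^ 4) * den x + (x ^ 4 + x ^ 3 - x - 1#) * (x ^ 6 - x ^ 5 - 1#) ≈ 1#
  den-coprime-reciprocal = solve 1 (λ x →
    (x :^ 2 :+ x :- x :^ 4) :* :den x :+ (x :^ 4 :+ x :^ 3 :- x :- :1) :* (x :^ 6 :- x :^ 5 :- :1)
    := :1) refl

  -- The curves A = 0 and C = 0 meet only where x or y is a square root of -1;
  -- the certificate comes from linear algebra over 𝔽₃.
  A-C-nullstellensatz : ∀ x y → A (x + y) (x * y) ≈ 0# → C (x + y) (x * y) ≈ 0# →
                        ((x ^ 2 + 1#) * (y ^ 2 + 1#)) ^ 3 ≈ 0#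
  A-C-nullstellensatz x y A≈0 C≈0 = begin
    ((x ^ 2 + 1#) * (y ^ 2 + 1#)) ^ 3                    ≈⟨ certificate x y ⟩
    u * A (x + y) (x * y) + v * C (x + y) (x * y)        ≈⟨ +-cong (*-congˡ A≈0) (*-congˡ C≈0) ⟩
    u * 0# + v * 0#                                      ≈⟨ +-cong (zeroʳ u) (zeroʳ v) ⟩
    0# + 0#                                              ≈⟨ +-identityˡ 0# ⟩
    0#                                                   ∎
    where
    :U :V : ∀ {n} → Polynomial n → Polynomial n → Polynomial n
    :U s p = s :^ 3 :- s :^ 2 :* p :- s :* p :^ 2 :- s :^ 2 :+ s :* p :- s :- p :^ 2 :- p
    :V s p = s :^ 2 :* p :^ 2 :+ s :^ 2 :* p :+ s :^ 2 :- s :* p :^ 3 :- s :+ p :^ 4 :- p :^ 2 :+ :1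
    U V : Carrier → Carrier → Carrier
    U s p = ⟦ :U (var 0F) (var 1F) ⟧ (s ∷ p ∷ [])
    V s p = ⟦ :V (var 0F) (var 1F) ⟧ (s ∷ p ∷ [])
    u v : Carrier
    u = U (x + y) (x * y)
    v = V (x + y) (x * y)
    certificate : ∀ x y → ((x ^ 2 + 1#) * (y ^ 2 + 1#)) ^ 3 ≈
      U (x + y) (x * y) * A (x + y) (x * y) + V (x + y) (x * y) * C (x + y) (x * y)
    certificate = solve 2 (λ x y → let s = x :+ y ; p = x :* y in
      ((x :^ 2 :+ :1) :* (y :^ 2 :+ :1)) :^ 3 := :U s p :* :A s p :+ :V s p :* :C s p) refl

-- Finite Heyting fields: apartness, zero divisors and quotients.

module FiniteField {c ℓ₁ ℓ₂} (F : HeytingField c ℓ₁ ℓ₂)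
  {n} (card : FieldDefs.HasCardinality F n) where

  open FieldDefs F
  open CommutativeRing commutativeRing using (ring; semiring)
  open FiniteSetoid setoid card public
  open import Algebra.Apartness.Properties.HeytingCommutativeRing heytingCommutativeRing
    using (1#0; x-0≈x; invertibleʳ⇒#)
  open import Algebra.Properties.Ring ring using (x[y-z]≈xy-xz; x∙y⁻¹≈ε⇒x≈y; x≈y⇒x∙y⁻¹≈ε)
  open import Algebra.Properties.Semiring.Mult semiring using (×1-homo-*) renaming (_×_ to _·_)
  open import Relation.Binary.Reasoning.Setoid setoid

  #⇒≉ : ∀ {x y} → x # y → ¬ x ≈ y
  #⇒≉ x#y x≈y = proj₂ (tight _ _) x≈y x#y

  1≉0 : ¬ 1# ≈ 0#
  1≉0 = #⇒≉ 1#0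

  infix 9 _⁻¹

  _⁻¹ : ∀ {x} → x # 0# → Carrier
  x#0 ⁻¹ = proj₁ (#⇒invertible x#0)

  *-inverseʳ : ∀ {x} (x#0 : x # 0#) → x * x#0 ⁻¹ ≈ 1#
  *-inverseʳ {x} x#0 = trans (*-congʳ (sym (x-0≈x x))) (proj₂ (proj₂ (#⇒invertible x#0)))

  -- The difference `x - y` is invertible and cancels. This form yields both the injectivity of
  -- multiplication by a nonzero element and, with one side zero, `integral`.
  x#y×zx≈zy⇒z≈0 : ∀ {x y z} → x # y → z * x ≈ z * y → z ≈ 0#
  x#y×zx≈zy⇒z≈0 {x} {y} {z} x#y zx≈zy with w , _ , [x-y]w≈1 ← #⇒invertible x#y = begin
    z                   ≈⟨ *-identityʳ z ⟨
    z * 1#              ≈⟨ *-congˡ [x-y]w≈1 ⟨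
    z * ((x - y) * w)   ≈⟨ *-assoc z (x - y) w ⟨
    z * (x - y) * w     ≈⟨ *-congʳ (x[y-z]≈xy-xz z x y) ⟩
    (z * x - z * y) * w ≈⟨ *-congʳ (x≈y⇒x∙y⁻¹≈ε zx≈zy) ⟩
    0# * w              ≈⟨ zeroˡ w ⟩
    0#                  ∎

  -- Multiplication by x is injective by tightness, hence surjective by
  -- finiteness, so that 1 is a multiple of x.
  ≉⇒# : ∀ {x} → ¬ x ≈ 0# → x # 0#
  ≉⇒# {x} x≉0 with (y , _) , xy≈1 ← injective⇒strictlySurjective-on (λ _ → yes tt)
      (λ (y , _) → x * y , tt)
      (λ xy≈xz → proj₁ (tight _ _) λ y#z → x≉0 (x#y×zx≈zy⇒z≈0 y#z xy≈xz))
      (λ _ _ → tt) (1# , tt) =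
    invertibleʳ⇒# (y , trans (*-congʳ (x-0≈x x)) xy≈1)

  integral : ∀ {x y} → x * y ≈ 0# → x ≈ 0# ⊎ y ≈ 0#
  integral {x} {y} xy≈0 with y ≟ 0#
  ... | yes y≈0 = inj₂ y≈0
  ... | no  y≉0 = inj₁ (x#y×zx≈zy⇒z≈0 (≉⇒# y≉0) (trans xy≈0 (sym (zeroʳ x))))

  x^m≈0⇒x≈0 : ∀ m {x} → x ^ m ≈ 0# → x ≈ 0#
  x^m≈0⇒x≈0 ℕ.zero    1≈0    = contradiction 1≈0 1≉0
  x^m≈0⇒x≈0 (ℕ.suc m) xx^m≈0 = [ (λ x≈0 → x≈0) , x^m≈0⇒x≈0 m ]′ (integral xx^m≈0)

  -- Without zero divisors, a vanishing power has a vanishing base. Applied to the cardinality, a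
  -- power of 3, this gives characteristic 3.
  p^m×1≈0⇒p×1≈0 : ∀ p m → (p ℕ.^ m) · 1# ≈ 0# → p · 1# ≈ 0#
  p^m×1≈0⇒p×1≈0 p ℕ.zero    1+0≈0 = contradiction (trans (sym (+-identityʳ 1#)) 1+0≈0) 1≉0
  p^m×1≈0⇒p×1≈0 p (ℕ.suc m) eq    =
    [ (λ p≈0 → p≈0) , p^m×1≈0⇒p×1≈0 p m ]′ (integral (trans (sym (×1-homo-* p (p ℕ.^ m))) eq))

  quotient-* : ∀ x {y} (y#0 : y # 0#) → quotient x y y#0 * y ≈ x
  quotient-* x {y} y#0 = begin
    x * y#0 ⁻¹ * y     ≈⟨ *-assoc x _ y ⟩
    x * (y#0 ⁻¹ * y)   ≈⟨ *-congˡ (*-comm _ y) ⟩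
    x * (y * y#0 ⁻¹)   ≈⟨ *-congˡ (*-inverseʳ y#0) ⟩
    x * 1#             ≈⟨ *-identityʳ x ⟩
    x                  ∎

  quotient-unique : ∀ {x y z} (y#0 : y # 0#) → z * y ≈ x → z ≈ quotient x y y#0
  quotient-unique {x} {y} {z} y#0 zy≈x = begin
    z                  ≈⟨ *-identityʳ z ⟨
    z * 1#             ≈⟨ *-congˡ (*-inverseʳ y#0) ⟨
    z * (y * y#0 ⁻¹)   ≈⟨ *-assoc z y _ ⟨
    z * y * y#0 ⁻¹     ≈⟨ *-congʳ zy≈x ⟩
    x * y#0 ⁻¹         ∎

  -- The inverse is extracted from an apartness proof, and the two proofs may differ; uniqueness of
  -- the quotient removes the dependence.
  quotient-cong : ∀ {x x′ y y′} (y#0 : y # 0#) (y′#0 : y′ # 0#) → x ≈ x′ → y ≈ y′ →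
                  quotient x y y#0 ≈ quotient x′ y′ y′#0
  quotient-cong y#0 y′#0 x≈x′ y≈y′ =
    quotient-unique y′#0 (trans (*-congˡ (sym y≈y′)) (trans (quotient-* _ y#0) x≈x′))

  quotient-injective : ∀ {x x′ y y′} (y#0 : y # 0#) (y′#0 : y′ # 0#) →
                       quotient x y y#0 ≈ quotient x′ y′ y′#0 → x * y′ ≈ x′ * y
  quotient-injective {x} {x′} {y} {y′} y#0 y′#0 z≈z′ = begin
    x * y′                             ≈⟨ *-congʳ (quotient-* x y#0) ⟨
    quotient x y y#0 * y * y′          ≈⟨ *-congʳ (*-congʳ z≈z′) ⟩
    quotient x′ y′ y′#0 * y * y′       ≈⟨ *-assoc _ y y′ ⟩
    quotient x′ y′ y′#0 * (y * y′)     ≈⟨ *-congˡ (*-comm y y′) ⟩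
    quotient x′ y′ y′#0 * (y′ * y)     ≈⟨ *-assoc _ y′ y ⟨
    quotient x′ y′ y′#0 * y′ * y       ≈⟨ *-congʳ (quotient-* x′ y′#0) ⟩
    x′ * y                             ∎

-- Evenness of `k` enters here: 9 is 1 modulo 4, hence so is `q`.
3^2j≡1+4m : ∀ j → ∃ λ m → 3 ℕ.^ (j ℕ.* 2) ≡ 1 ℕ.+ 4 ℕ.* m
3^2j≡1+4m ℕ.zero = 0 , ≡.refl
3^2j≡1+4m (ℕ.suc j) with m , eq ← 3^2j≡1+4m j =
  2 ℕ.+ 9 ℕ.* m , ≡.trans (≡.cong (λ q → 3 ℕ.* (3 ℕ.* q)) eq) (lemma m)
  where
  open import Data.Nat.Tactic.RingSolver using (solve-∀)
  lemma : ∀ m → 3 ℕ.* (3 ℕ.* (1 ℕ.+ 4 ℕ.* m)) ≡ 1 ℕ.+ 4 ℕ.* (2 ℕ.+ 9 ℕ.* m)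
  lemma = solve-∀

-- Conjugation and square roots of -1 when `q` is 1 modulo 4.

module _ {c ℓ₁ ℓ₂} (F : HeytingField c ℓ₁ ℓ₂)
  (k m : ℕ) (q≡1+4m : 3 ℕ.^ k ≡ 1 ℕ.+ 4 ℕ.* m)
  (card : FieldDefs.HasCardinality F ((3 ℕ.^ k) ℕ.^ 2)) where

  open FieldDefs F
  open FiniteField F card
  open CommutativeRing commutativeRing using (semiring; ring)
  open import Algebra.Properties.Semiring.Mult semiring using (×-congˡ) renaming (_×_ to _·_)
  open import Algebra.Properties.Ring ring
    using (x∙y⁻¹≈ε⇒x≈y; x≈y⇒x∙y⁻¹≈ε; -0#≈0#; -‿involutive; -‿distribˡ-*; -‿distribʳ-*)
  open import Relation.Binary.Reasoning.Setoid setoid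

  1+1+1≈0 : ThreeIsZero commutativeRing
  1+1+1≈0 = begin
    1# + 1# + 1#   ≈⟨ +-assoc 1# 1# 1# ⟩
    1# + (1# + 1#) ≈⟨ +-congˡ (+-congˡ (+-identityʳ 1#)) ⟨
    3 · 1#         ≈⟨ p^m×1≈0⇒p×1≈0 3 (k ℕ.* 2)
                        (trans (×-congˡ (≡.sym (ℕ.^-*-assoc 3 k 2))) cardinality×1≈0) ⟩
    0#             ∎
    where open FiniteRing commutativeRing card

  open CharacteristicThree commutativeRing 1+1+1≈0 hiding (_^_)

  -- Conjugation over the subfield with `q` elements.
  φ : Carrier → Carrier
  φ = frob k

  -- The factor by which `φ` multiplies `x` depends only on `x ^ 4`; the congruence of `q` modulo 4
  -- is used through this.
  φ≈x*x⁴ᵐ : ∀ x → φ x ≈ x * (x ^ 4) ^ m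
  φ≈x*x⁴ᵐ x = begin
    x ^ (3 ℕ.^ k)         ≈⟨ ^-congʳ x q≡1+4m ⟩
    x * x ^ (4 ℕ.* m)     ≈⟨ *-congˡ (^-assocʳ x 4 m) ⟨
    x * (x ^ 4) ^ m       ∎

  1^n≈1 : ∀ n → 1# ^ n ≈ 1#
  1^n≈1 ℕ.zero    = refl
  1^n≈1 (ℕ.suc n) = trans (*-identityˡ _) (1^n≈1 n)

  μ[q+1] : Pred Carrier _
  μ[q+1] = μ (3 ℕ.^ k ℕ.+ 1)

  x^[q+1]≈x*φx : ∀ x → x ^ (3 ℕ.^ k ℕ.+ 1) ≈ x * φ x
  x^[q+1]≈x*φx x = begin
    x ^ (3 ℕ.^ k ℕ.+ 1)   ≈⟨ ^-congʳ x (ℕ.+-comm (3 ℕ.^ k) 1) ⟩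
    x * φ x               ∎

  unitary : ∀ {x} → μ[q+1] x → x * φ x ≈ 1#
  unitary {x} x∈μ = trans (sym (x^[q+1]≈x*φx x)) x∈μ

  -- A square root of -1 satisfies `x ^ 4 = 1`, so `φ` fixes it and `x * φ x` is -1 instead of 1.
  x²+1≉0 : ∀ {x} → μ[q+1] x → ¬ x ^ 2 + 1# ≈ 0#
  x²+1≉0 {x} x∈μ x²+1≈0 = 1≉0 (x≈-x⇒x≈0 (begin
    1#                             ≈⟨ unitary x∈μ ⟨
    x * φ x                        ≈⟨ *-congˡ (φ≈x*x⁴ᵐ x) ⟩
    x * (x * (x ^ 4) ^ m)          ≈⟨ *-congˡ (*-congˡ (trans (^-congˡ m x⁴≈1) (1^n≈1 m))) ⟩
    x * (x * 1#)                   ≈⟨ solve 1 (λ x → x :^ 2 := (x :^ 2 :+ :1) :- :1) refl x ⟩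
    (x ^ 2 + 1#) - 1#              ≈⟨ +-congʳ x²+1≈0 ⟩
    0# - 1#                        ≈⟨ +-identityˡ (- 1#) ⟩
    - 1#                           ∎))
    where
    x⁴≈1 : x ^ 4 ≈ 1#
    x⁴≈1 = begin
      x ^ 4                                   ≈⟨ solve 1 (λ x → x :^ 4 := (x :^ 2 :+ :1) :* (x :^ 2 :- :1) :+ :1) refl x ⟩
      (x ^ 2 + 1#) * (x ^ 2 - 1#) + 1#        ≈⟨ +-congʳ (*-congʳ x²+1≈0) ⟩
      0# * (x ^ 2 - 1#) + 1#                  ≈⟨ +-congʳ (zeroˡ _) ⟩
      0# + 1#                                 ≈⟨ +-identityˡ 1# ⟩
      1#                                      ∎

  x²≈0⇒x≈0 : ∀ {x} → x ^ 2 ≈ 0# → x ≈ 0#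
  x²≈0⇒x≈0 = x^m≈0⇒x≈0 2

  -- Here a ± i b are two conjugate values over 𝔽₉ ⊆ 𝔽_q whose product vanishes:
  -- a / b is a square root of -1, hence fixed by φ as 4 ∣ q - 1, whereas the
  -- hypotheses on φ say that φ negates it.
  conjugate-cancellation : ∀ {a b} u → φ a * u ≈ a → φ b * u ≈ - b →
                           a ^ 2 + b ^ 2 ≈ 0# → a ≈ 0# × b ≈ 0#
  conjugate-cancellation {a} {b} u φa*u≈a φb*u≈-b a²+b²≈0 =
    [ (λ a≈0 → a≈0 , x²≈0⇒x≈0 (begin
        b ^ 2             ≈⟨ +-identityˡ (b ^ 2) ⟨
        0# + b ^ 2        ≈⟨ +-congʳ (trans (^-congˡ 2 a≈0) (zeroˡ _)) ⟨
        a ^ 2 + b ^ 2     ≈⟨ a²+b²≈0 ⟩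
        0#                ∎))
    , (λ b≈0 → x²≈0⇒x≈0 (begin
        a ^ 2             ≈⟨ +-identityʳ (a ^ 2) ⟨
        a ^ 2 + 0#        ≈⟨ +-congˡ (trans (^-congˡ 2 b≈0) (zeroˡ _)) ⟨
        a ^ 2 + b ^ 2     ≈⟨ a²+b²≈0 ⟩
        0#                ∎) , b≈0)
    ]′ (integral (x≈-x⇒x≈0 (begin
      a * b                          ≈⟨ *-congʳ φa*u≈a ⟨
      φ a * u * b                    ≈⟨ solve 3 (λ a u b → a :* u :* b := a :* b :* u) refl (φ a) u b ⟩
      φ a * b * u                    ≈⟨ *-congʳ φa*b≈a*φb ⟩
      a * φ b * u                    ≈⟨ *-assoc a (φ b) u ⟩
      a * (φ b * u)                  ≈⟨ *-congˡ φb*u≈-b ⟩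
      a * - b                        ≈⟨ -‿distribʳ-* a b ⟨
      - (a * b)                      ∎)))
    where
    a⁴≈b⁴ : a ^ 4 ≈ b ^ 4
    a⁴≈b⁴ = x∙y⁻¹≈ε⇒x≈y _ _ (begin
      a ^ 4 - b ^ 4                            ≈⟨ solve 2 (λ a b → a :^ 4 :- b :^ 4
                                                    := (a :^ 2 :+ b :^ 2) :* (a :^ 2 :- b :^ 2)) refl a b ⟩
      (a ^ 2 + b ^ 2) * (a ^ 2 - b ^ 2)        ≈⟨ *-congʳ a²+b²≈0 ⟩
      0# * (a ^ 2 - b ^ 2)                     ≈⟨ zeroˡ _ ⟩
      0#                                       ∎)
    φa*b≈a*φb : φ a * b ≈ a * φ b
    φa*b≈a*φb = begin
      φ a * b                   ≈⟨ *-congʳ (φ≈x*x⁴ᵐ a) ⟩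
      a * (a ^ 4) ^ m * b       ≈⟨ *-congʳ (*-congˡ (^-congˡ m a⁴≈b⁴)) ⟩
      a * (b ^ 4) ^ m * b       ≈⟨ solve 3 (λ a c b → a :* c :* b := a :* (b :* c)) refl a _ b ⟩
      a * (b * (b ^ 4) ^ m)     ≈⟨ *-congˡ (φ≈x*x⁴ᵐ b) ⟨
      a * φ b                   ∎

  -- `g` is defined on μ and preserves it.

  -- A zero `x` of `den` in μ makes its conjugate `1 / x` a zero too, so `x` is also a zero of the
  -- reciprocal polynomial, against coprimality.
  den≉0 : ∀ {x} → μ[q+1] x → ¬ den x ≈ 0#
  den≉0 {x} x∈μ den≈0 = 1≉0 (begin
    1#                                                     ≈⟨ den-coprime-reciprocal x ⟨
    (x ^ 2 + x - x ^ 4) * den x + v * reciprocal           ≈⟨ +-cong (*-congˡ den≈0) (*-congˡ reciprocal≈0) ⟩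
    (x ^ 2 + x - x ^ 4) * 0# + v * 0#                      ≈⟨ +-cong (zeroʳ _) (zeroʳ v) ⟩
    0# + 0#                                                ≈⟨ +-identityˡ 0# ⟩
    0#                                                     ∎)
    where
    v reciprocal : Carrier
    v          = x ^ 4 + x ^ 3 - x - 1#
    reciprocal = x ^ 6 - x ^ 5 - 1#
    den[φx]≈0 : den (φ x) ≈ 0#
    den[φx]≈0 = begin
      den (φ x)   ≈⟨ frob-⟦⟧ k (:den (var 0F)) (x ∷ []) ⟨
      φ (den x)   ≈⟨ frob-cong k den≈0 ⟩
      φ 0#        ≈⟨ frob-embed k 0₃ ⟩
      0#          ∎
    reciprocal≈0 : reciprocal ≈ 0#
    reciprocal≈0 = begin
      reciprocal                          ≈⟨ *-identityˡ reciprocal ⟨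
      1# * reciprocal                     ≈⟨ *-congʳ (unitary x∈μ) ⟨
      -- The numerator factors as `num x = - x * reciprocal`.
      x * φ x * reciprocal                ≈⟨ solve 2 (λ x x̄ → x :* x̄ :* (x :^ 6 :- x :^ 5 :- :1)
                                                := :- (x̄ :* :num x)) refl x (φ x) ⟩
      - (φ x * num x)                     ≈⟨ -‿cong (*-congˡ (num≈x⁷*den-x̄ (unitary x∈μ))) ⟩
      - (φ x * (x ^ 7 * den (φ x)))       ≈⟨ -‿cong (*-congˡ (*-congˡ den[φx]≈0)) ⟩
      - (φ x * (x ^ 7 * 0#))              ≈⟨ solve 2 (λ x x̄ → :- (x̄ :* (x :^ 7 :* con 0₃)) := con 0₃) refl x (φ x) ⟩
      0#                                  ∎

  den#0 : ∀ x → μ[q+1] x → den x # 0#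
  den#0 x x∈μ = ≉⇒# (den≉0 x∈μ)

  g : ∀ x → μ[q+1] x → Carrier
  g x x∈μ = quotient (num x) (den x) (den#0 x x∈μ)

  -- The relation between `num` and `den` applies to `x` and to `x̄`, so in the norm of `g x` the
  -- values of `den` cancel and `(x * x̄) ^ 7` remains.
  g-closed : ∀ x (x∈μ : μ[q+1] x) → μ[q+1] (g x x∈μ)
  g-closed x x∈μ = begin
    g x x∈μ ^ (3 ℕ.^ k ℕ.+ 1)                    ≈⟨ x^[q+1]≈x*φx (g x x∈μ) ⟩
    num x * w * φ (num x * w)                    ≈⟨ *-congˡ (^-distrib-* (num x) w (3 ℕ.^ k)) ⟩
    num x * w * (φ (num x) * φ w)                ≈⟨ *-cong (*-congʳ (num≈x⁷*den-x̄ xx̄≈1))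
                                                      (*-congʳ (trans φ-num (num≈x⁷*den-x̄ (trans (*-comm _ _) xx̄≈1)))) ⟩
    x ^ 7 * den x̄ * w * (x̄ ^ 7 * den x * φ w)    ≈⟨ solve 6 (λ a ā d d̄ w w̄ →
                                                      a :* d̄ :* w :* (ā :* d :* w̄)
                                                      := a :* ā :* (d :* w :* (d̄ :* w̄)))
                                                      refl (x ^ 7) (x̄ ^ 7) (den x) (den x̄) w (φ w) ⟩
    x ^ 7 * x̄ ^ 7 * (den x * w * (den x̄ * φ w))  ≈⟨ *-cong (^-distrib-* x x̄ 7) (*-cong (sym dw≈1) (sym d̄w̄≈1)) ⟨
    (x * x̄) ^ 7 * (1# * 1#)                      ≈⟨ *-congʳ (^-congˡ 7 xx̄≈1) ⟩
    1# ^ 7 * (1# * 1#)                           ≈⟨ solve 0 (:1 :^ 7 :* (:1 :* :1) := :1) refl ⟩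
    1#                                           ∎
    where
    x̄ w : Carrier
    x̄ = φ x
    w = den#0 x x∈μ ⁻¹
    xx̄≈1 : x * x̄ ≈ 1#
    xx̄≈1 = unitary x∈μ
    φ-num : φ (num x) ≈ num x̄
    φ-num = frob-⟦⟧ k (:num (var 0F)) (x ∷ [])
    dw≈1 : den x * w ≈ 1#
    dw≈1 = *-inverseʳ (den#0 x x∈μ)
    d̄w̄≈1 : den x̄ * φ w ≈ 1#
    d̄w̄≈1 = begin
      den x̄ * φ w        ≈⟨ *-congʳ (frob-⟦⟧ k (:den (var 0F)) (x ∷ [])) ⟨
      φ (den x) * φ w    ≈⟨ ^-distrib-* (den x) w (3 ℕ.^ k) ⟨
      φ (den x * w)      ≈⟨ frob-cong k dw≈1 ⟩
      φ 1#               ≈⟨ frob-embed k 1₃ ⟩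
      1#                 ∎

  g-cong : ∀ {x y} (x∈μ : μ[q+1] x) (y∈μ : μ[q+1] y) → x ≈ y → g x x∈μ ≈ g y y∈μ
  g-cong x∈μ y∈μ x≈y = quotient-cong (den#0 _ x∈μ) (den#0 _ y∈μ) (num-cong x≈y) (den-cong x≈y)

  -- Injectivity of `g` on μ.

  module _ {x y} (x∈μ : μ[q+1] x) (y∈μ : μ[q+1] y) where

    private
      x̄ ȳ s p p̄ : Carrier
      x̄ = φ x
      ȳ = φ y
      s = x + y
      p = x * y
      p̄ = x̄ * ȳ

    φp≈p̄ : φ p ≈ p̄
    φp≈p̄ = ^-distrib-* x y (3 ℕ.^ k)

    pp̄≈1 : p * p̄ ≈ 1#
    pp̄≈1 = begin
      x * y * (x̄ * ȳ)      ≈⟨ solve 4 (λ x y x̄ ȳ → x :* y :* (x̄ :* ȳ) := x :* x̄ :* (y :* ȳ)) refl x y x̄ ȳ ⟩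
      x * x̄ * (y * ȳ)      ≈⟨ *-cong (unitary x∈μ) (unitary y∈μ) ⟩
      1# * 1#              ≈⟨ *-identityˡ 1# ⟩
      1#                   ∎

    -- This is `1 / x + 1 / y = (x + y) / (x y)`.
    φs≈sp̄ : φ s ≈ s * p̄
    φs≈sp̄ = begin
      φ (x + y)                      ≈⟨ frob-+ k x y ⟩
      x̄ + ȳ                          ≈⟨ +-cong (*-identityˡ x̄) (*-identityˡ ȳ) ⟨
      1# * x̄ + 1# * ȳ                ≈⟨ +-cong (*-congʳ (unitary y∈μ)) (*-congʳ (unitary x∈μ)) ⟨
      y * ȳ * x̄ + x * x̄ * ȳ          ≈⟨ solve 4 (λ x y x̄ ȳ → y :* ȳ :* x̄ :+ x :* x̄ :* ȳ
                                          := (x :+ y) :* (x̄ :* ȳ)) refl x y x̄ ȳ ⟩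
      s * p̄                          ∎

    -- From `1 / x - 1 / y = - (x - y) / (x y)`; this sign is what sets `B` apart from `A` under
    -- conjugation.
    φ[x-y]*p≈-[x-y] : φ (x - y) * p ≈ - (x - y)
    φ[x-y]*p≈-[x-y] = begin
      φ (x - y) * p                      ≈⟨ *-congʳ (trans (frob-+ k x (- y)) (+-congˡ (frob-neg k y))) ⟩
      (x̄ - ȳ) * (x * y)                  ≈⟨ solve 4 (λ x y x̄ ȳ → (x̄ :- ȳ) :* (x :* y)
                                              := :- (x :* (y :* ȳ) :- y :* (x :* x̄))) refl x y x̄ ȳ ⟩
      - (x * (y * ȳ) - y * (x * x̄))      ≈⟨ -‿cong (+-cong (*-congˡ (unitary y∈μ)) (-‿cong (*-congˡ (unitary x∈μ)))) ⟩
      - (x * 1# - y * 1#)                ≈⟨ -‿cong (+-cong (*-identityʳ x) (-‿cong (*-identityʳ y))) ⟩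
      - (x - y)                          ∎

    φA*p³≈A : φ (A s p) * p ^ 3 ≈ A s p
    φA*p³≈A = begin
      φ (A s p) * p ^ 3          ≈⟨ *-congʳ (frob-⟦⟧ k :A₂ (s ∷ p ∷ [])) ⟩
      A (φ s) (φ p) * p ^ 3      ≈⟨ *-congʳ (⟦⟧-cong :A₂ (φs≈sp̄ ∷ φp≈p̄ ∷ [])) ⟩
      A (s * p̄) p̄ * p ^ 3        ≈⟨ reciprocal-A s pp̄≈1 ⟩
      A s p                      ∎
      where :A₂ = :A (var 0F) (var 1F)

    φC*p²≈C : φ (C s p) * p ^ 2 ≈ C s p
    φC*p²≈C = begin
      φ (C s p) * p ^ 2          ≈⟨ *-congʳ (frob-⟦⟧ k :C₂ (s ∷ p ∷ [])) ⟩
      C (φ s) (φ p) * p ^ 2      ≈⟨ *-congʳ (⟦⟧-cong :C₂ (φs≈sp̄ ∷ φp≈p̄ ∷ [])) ⟩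
      C (s * p̄) p̄ * p ^ 2        ≈⟨ reciprocal-C s pp̄≈1 ⟩
      C s p                      ∎
      where :C₂ = :C (var 0F) (var 1F)

    φB*p³≈-B : φ ((x - y) * C s p) * p ^ 3 ≈ - ((x - y) * C s p)
    φB*p³≈-B = begin
      φ ((x - y) * C s p) * p ^ 3                ≈⟨ *-congʳ (^-distrib-* (x - y) (C s p) (3 ℕ.^ k)) ⟩
      φ (x - y) * φ (C s p) * p ^ 3              ≈⟨ solve 3 (λ d c p → d :* c :* p :^ 3 := d :* p :* (c :* p :^ 2))
                                                      refl (φ (x - y)) (φ (C s p)) p ⟩
      φ (x - y) * p * (φ (C s p) * p ^ 2)        ≈⟨ *-cong φ[x-y]*p≈-[x-y] φC*p²≈C ⟩
      - (x - y) * C s p                          ≈⟨ -‿distribˡ-* (x - y) (C s p) ⟨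
      - ((x - y) * C s p)                        ∎

    A≈0⇒C≉0 : A s p ≈ 0# → ¬ C s p ≈ 0#
    A≈0⇒C≉0 A≈0 C≈0 =
      [ x²+1≉0 x∈μ , x²+1≉0 y∈μ ]′ (integral (x^m≈0⇒x≈0 3 (A-C-nullstellensatz x y A≈0 C≈0)))

    g-injective : g x x∈μ ≈ g y y∈μ → x ≈ y
    g-injective gx≈gy = decidable-stable (x ≟ y) λ x≉y → off-diagonal (x≉y ∘ x∙y⁻¹≈ε⇒x≈y x y)
      where
      module _ (x-y≉0 : ¬ x - y ≈ 0#) where
        B = (x - y) * C s p
        A²+B²≈0 : A s p ^ 2 + B ^ 2 ≈ 0#
        A²+B²≈0 = [ (λ x-y≈0 → contradiction x-y≈0 x-y≉0) , (λ eq → eq) ]′ (integral (begin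
          (x - y) * (A s p ^ 2 + B ^ 2)            ≈⟨ -‿involutive _ ⟨
          - - ((x - y) * (A s p ^ 2 + B ^ 2))      ≈⟨ -‿cong (num-den-factorisation x y) ⟨
          - (num x * den y - num y * den x)        ≈⟨ -‿cong (x≈y⇒x∙y⁻¹≈ε
                                                        (quotient-injective (den#0 x x∈μ) (den#0 y y∈μ) gx≈gy)) ⟩
          - 0#                                     ≈⟨ -0#≈0# ⟩
          0#                                       ∎))
        A≈0×B≈0 : A s p ≈ 0# × B ≈ 0#
        -- `A` and `B` share the multiplier `p ^ 3`, so conjugation negates their ratio.
        A≈0×B≈0 = conjugate-cancellation (p ^ 3) φA*p³≈A φB*p³≈-B A²+B²≈0
        C≈0 : C s p ≈ 0#
        C≈0 = [ (λ x-y≈0 → contradiction x-y≈0 x-y≉0) , (λ eq → eq) ]′ (integral (proj₂ A≈0×B≈0))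
        off-diagonal : ⊥
        off-diagonal = A≈0⇒C≉0 (proj₁ A≈0×B≈0) C≈0

  -- From injectivity to a permutation of the finite set μ.

  g-permutes : Permutes num den μ[q+1]
  g-permutes = record
    { den#0       = den#0
    ; closed      = g-closed
    ; isBijection = record
      { isInjection = record
        { isCongruent = record
          { cong           = λ {(_ , x∈μ)} {(_ , y∈μ)} → g-cong x∈μ y∈μ
          ; isEquivalence₁ = On.isEquivalence proj₁ isEquivalence
          ; isEquivalence₂ = On.isEquivalence proj₁ isEquivalence
          }
        ; injective = λ {(_ , x∈μ)} {(_ , y∈μ)} → g-injective x∈μ y∈μ
        }
      ; surjective = λ y∈μ →
          let ((x , x∈μ) , gx≈y) = g-surjective y∈μ in
          (x , x∈μ) , λ {(_ , z∈μ)} z≈x → trans (g-cong z∈μ x∈μ z≈x) gx≈y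
      }
    }
    where
    restriction : ∃ μ[q+1] → ∃ μ[q+1]
    restriction (x , x∈μ) = g x x∈μ , g-closed x x∈μ

    g-surjective : StrictlySurjective (_≈_ on proj₁) restriction
    g-surjective = injective⇒strictlySurjective-on (λ x → x ^ (3 ℕ.^ k ℕ.+ 1) ≟ 1#) restriction
      (λ {(_ , x∈μ)} {(_ , y∈μ)} → g-injective x∈μ y∈μ)
      (λ x≈y x∈μ → trans (^-congˡ (3 ℕ.^ k ℕ.+ 1) (sym x≈y)) x∈μ)

theorem2p3 :
    ∀ {c ℓ₁ ℓ₂} (F : HeytingField c ℓ₁ ℓ₂) (k : ℕ) → 0 ℕ.< k → 2 ∣ k →
    let open FieldDefs F
        q = 3 ℕ.^ k
    in HasCardinality (q ℕ.^ 2) →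
       Permutes (λ x → - (x ^ 7) + x ^ 6 + x) (λ x → x ^ 6 + x - 1#) (μ (q ℕ.+ 1))
theorem2p3 F k _ (divides j k≡j*2) card with m , eq ← 3^2j≡1+4m j =
  g-permutes F k m (≡.trans (≡.cong (3 ℕ.^_) k≡j*2) eq) card
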